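{- For every integer $n\ge 1$, $$d_{\lceil (n-2)/2 \rceil}^{\mathrm{ -DU}}(n)= D_{\lfloor (n+2)/2 \rfloor}^{ -D},$$ $$d_{\lceil (n-1)/2 \rceil}^{\mathrm{ -UD}}(n)= D_{\lfloor (n+1)/2 \rfloor}^{ - },$$ $$d_{\lceil n/2 \rceil}^{\mathrm{+DU}}(n)= D_{\lfloor n/2 \rfloor}^{B},$$ $$d_{\lceil (n+1)/2 \rceil}^{\mathrm{+UD}}(n)= D_{\lfloor (n-1)/2 \rfloor}^{B}.$$
   Context: A signed permutation of length $n$ is a permutation $\sigma$ of $\{ -n,\ldots,-1,1,\ldots,n\}$ with $\sigma(-i)=-\sigma(i)$ for all $i\in[n]=\{1,\ldots,n\}$; write $\sigma_i=\sigma(i)$ for $i\in[n]$. The group of these is $\mathfrak{S}_n^B$. A fixed point of $\sigma$ is a positive integer $i\in[n]$ with $\sigma(i)=i$. Types of alternating signed permutations $\sigma\in\mathfrak{S}_n^B$ (the chain of alternating strict inequalities runs through $\sigma_n$): - type $\mathrm{ -DU}$: $0>\sigma_1>\sigma_2<\sigma_3>\cdots$; - type $\mathrm{ -UD}$: $0>\sigma_1<\sigma_2>\sigma_3<\cdots$; - type $\mathrm{+DU}$: $0<\sigma_1>\sigma_2<\sigma_3>\cdots$; - type $\mathrm{+UD}$: $0<\sigma_1<\sigma_2>\sigma_3<\cdots$. For each type $\ast\in\{\mathrm{ -DU},\mathrm{ -UD},\mathrm{+DU},\mathrm{+UD}\}$, $d_k^{\ast}(n)$ is the number of $\sigma\in\mathfrak{S}_n^B$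 of type $\ast$ having exactly $k$ fixed points. A derangement of type $B$ is a signed permutation with no fixed point; $\mathfrak{D}_n^B$ is the set of derangements of type $B$ in $\mathfrak{S}_n^B$. Put $D_n^B=|\mathfrak{D}_n^B|$, $D_n^{ - }=|\{\sigma\in\mathfrak{D}_n^B : \sigma(1)<0\}|$, and $D_n^{ -D}=|\{\sigma\in\mathfrak{D}_n^B : 0>\sigma(1)>\sigma(2)\}|$. Conventions: $D_0^B=1$ (the empty permutation), and for length $1$ the condition $\sigma(1)>\sigma(2)$ in the definition of $D_1^{ -D}$ is vacuous, so $D_1^{ -D}=1$. -}

module Defs where

open import Data.Empty using (⊥)
open import Data.Fin.Base using (Fin; toℕ)
open import Data.Fin.Properties as Fin using (all?; any?)
open import Data.Integer.Base as ℤ using (ℤ; 0ℤ; _◃_)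
open import Data.Integer.Properties as ℤ using ()
open import Data.List.Base using (List; []; _∷_; length; filter; mapMaybe; tabulate; allFin; cartesianProduct; cartesianProductWith)
open import Data.List.Membership.Propositional using (_∈_)
open import Data.List.Membership.Propositional.Properties using (∈-allFin; ∈-cartesianProduct⁺; ∈-cartesianProductWith⁺)
open import Data.List.Relation.Unary.All as All using (All; []; _∷_)
open import Data.List.Relation.Unary.AllPairs as AllPairs using (AllPairs; []; _∷_)
open import Data.List.Relation.Unary.Any using (Any; here; there)
open import Data.List.Relation.Unary.Unique.Propositional using (Unique)
open import Data.List.Relation.Unary.Unique.Propositional.Properties using (allFin⁺; cartesianProduct⁺; cartesianProductWith⁺)
open import Data.Maybe.Base as Maybe using (Maybe; just; nothing)
open import Data.Nat.Base using (ℕ; zero; suc)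
import Data.Nat.Properties as ℕ
open import Data.Product.Base using (∃; _×_; _,_; proj₁; proj₂)
open import Data.Product.Properties using (≡-dec)
open import Data.Sign.Base as Sign using (Sign; opposite)
import Data.Sign.Properties as Sign
open import Data.Sum.Base using (inj₁; inj₂)
open import Data.Unit.Base using (⊤; tt)
open import Data.Vec.Base as Vec using (Vec)
open import Data.Vec.Properties as Vec using (lookup∘tabulate; tabulate∘lookup; tabulate-cong)
open import Function.Bundles using (_↔_; Inverse; module Bijection; mk⤖)
open import Function.Definitions using (Bijective)
open import Function.Consequences.Propositional using (strictlySurjective⇒surjective)
open import Function.Properties.Bijection using (⤖⇒↔)
open import Function.Properties.Inverse using (↔⇒⤖)
open import Level using (0ℓ)
open import Relation.Binary.Definitions using (DecidableEquality)
open import Relation.Binary.PropositionalEquality using (_≡_; _≢_; refl; sym; trans; cong; subst)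
open import Relation.Nullary using (¬_; Dec; yes; no; contradiction)
open import Relation.Nullary.Decidable using (map′; _×-dec_; _⊎-dec_; _→-dec_; ¬?)
open import Relation.Unary using (Pred; Decidable)

-- The set {-n,…,-1,1,…,n}: the pair (s , i) stands for the integer s·(i+1),
-- since i : Fin n counts from 0.
±[_] : ℕ → Set
±[ n ] = Sign × Fin n

pos : ∀ {n} → Fin n → ±[ n ]
pos i = Sign.+ , i

neg : ∀ {n} → ±[ n ] → ±[ n ]
neg (s , i) = opposite s , i

value : ∀ {n} → ±[ n ] → ℤ
value (s , i) = s ◃ suc (toℕ i)

record SignedPermutation (n : ℕ) : Set where
  field
    permutation : ±[ n ] ↔ ±[ n ]
  open Inverse permutation public using (to; from)
  field
    odd : ∀ x → to (neg x) ≡ neg (to x)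

open SignedPermutation public using (to)

infix 4 _≈_
_≈_ : ∀ {n} → SignedPermutation n → SignedPermutation n → Set
σ ≈ τ = ∀ x → to σ x ≡ to τ x

word : ∀ {n} → SignedPermutation n → List ℤ
word σ = tabulate (λ i → value (to σ (pos i)))

infix 4 _≟_
_≟_ : ∀ {n} → DecidableEquality ±[ n ]
_≟_ = ≡-dec Sign._≟_ Fin._≟_

-- Without function extensionality
-- permutations are only compared up to _≈_; the lemmas
-- signedPermutations-complete and signedPermutations-unique say that the
-- list contains every signed permutation exactly once up to _≈_, so
-- filtering it and taking the length computes cardinalities.

dec∀ : ∀ {n} {P : Pred ±[ n ] 0ℓ} → Decidable P → Dec (∀ x → P x)
dec∀ P? = map′ (λ { (p , q) (Sign.- , i) → p i ; (p , q) (Sign.+ , i) → q i })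
               (λ f → (λ i → f (Sign.- , i)) , (λ i → f (Sign.+ , i)))
               (all? (λ i → P? (Sign.- , i)) ×-dec all? (λ i → P? (Sign.+ , i)))

dec∃ : ∀ {n} {P : Pred ±[ n ] 0ℓ} → Decidable P → Dec (∃ P)
dec∃ P? = map′ (λ { (inj₁ (i , p)) → (Sign.- , i) , p ; (inj₂ (i , p)) → (Sign.+ , i) , p })
               (λ { ((Sign.- , i) , p) → inj₁ (i , p) ; ((Sign.+ , i) , p) → inj₂ (i , p) })
               (any? (λ i → P? (Sign.- , i)) ⊎-dec any? (λ i → P? (Sign.+ , i)))

bijective? : ∀ {n} (f : ±[ n ] → ±[ n ]) → Dec (Bijective _≡_ _≡_ f)
bijective? f = map′
  (λ (inj , surj) → (λ {x} {y} → inj x y) , strictlySurjective⇒surjective surj)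
  (λ (inj , surj) → (λ x y → inj) , (λ y → proj₁ (surj y) , proj₂ (surj y) refl))
  (dec∀ (λ x → dec∀ (λ y → (f x ≟ f y) →-dec (x ≟ y)))
    ×-dec dec∀ (λ y → dec∃ (λ x → f x ≟ y)))

extend : ∀ {n} → Vec ±[ n ] n → ±[ n ] → ±[ n ]
extend w (Sign.+ , i) = Vec.lookup w i
extend w (Sign.- , i) = neg (Vec.lookup w i)

extend-odd : ∀ {n} (w : Vec ±[ n ] n) x → extend w (neg x) ≡ neg (extend w x)
extend-odd w (Sign.+ , i) = refl
extend-odd w (Sign.- , i) with Vec.lookup w i
... | Sign.+ , j = refl
... | Sign.- , j = refl

fromVec : ∀ {n} → Vec ±[ n ] n → Maybe (SignedPermutation n)
fromVec w with bijective? (extend w)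
... | yes b = just (record { permutation = ⤖⇒↔ (mk⤖ b) ; odd = extend-odd w })
... | no  _ = nothing

signs : List Sign
signs = Sign.- ∷ Sign.+ ∷ []

letters : ∀ n → List ±[ n ]
letters n = cartesianProduct signs (allFin n)

vectors : ∀ {A : Set} → List A → ∀ n → List (Vec A n)
vectors xs zero    = Vec.[] ∷ []
vectors xs (suc n) = cartesianProductWith Vec._∷_ xs (vectors xs n)

signedPermutations : ∀ n → List (SignedPermutation n)
signedPermutations n = mapMaybe fromVec (vectors (letters n) n)

private
  letters-complete : ∀ {n} (x : ±[ n ]) → x ∈ letters n
  letters-complete (Sign.- , i) = ∈-cartesianProduct⁺ {xs = signs} (here refl) (∈-allFin i)
  letters-complete (Sign.+ , i) = ∈-cartesianProduct⁺ {xs = signs} (there (here refl)) (∈-allFin i)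

  letters-unique : ∀ n → Unique (letters n)
  letters-unique n = cartesianProduct⁺ (((λ ()) ∷ []) ∷ [] ∷ []) (allFin⁺ n)

  vectors-complete : ∀ {A : Set} {xs : List A} → (∀ x → x ∈ xs) →
                     ∀ {n} (v : Vec A n) → v ∈ vectors xs n
  vectors-complete c Vec.[]      = here refl
  vectors-complete c (x Vec.∷ v) = ∈-cartesianProductWith⁺ Vec._∷_ (c x) (vectors-complete c v)

  vectors-unique : ∀ {A : Set} {xs : List A} → Unique xs → ∀ n → Unique (vectors xs n)
  vectors-unique u zero    = [] ∷ []
  vectors-unique u (suc n) = cartesianProductWith⁺ Vec._∷_ Vec.∷-injective u (vectors-unique u n)

  toVec : ∀ {n} → SignedPermutation n → Vec ±[ n ] n
  toVec σ = Vec.tabulate (λ i → to σ (pos i))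

  extend-toVec : ∀ {n} (σ : SignedPermutation n) x → extend (toVec σ) x ≡ to σ x
  extend-toVec σ (Sign.+ , i) = lookup∘tabulate _ i
  extend-toVec σ (Sign.- , i) =
    trans (cong neg (lookup∘tabulate _ i)) (sym (SignedPermutation.odd σ (pos i)))

  extend-toVec-bijective : ∀ {n} (σ : SignedPermutation n) →
                           Bijective _≡_ _≡_ (extend (toVec σ))
  extend-toVec-bijective σ =
      (λ {x} {y} eq → injective (trans (sym (extend-toVec σ x)) (trans eq (extend-toVec σ y))))
    , strictlySurjective⇒surjective
        (λ y → from y , trans (extend-toVec σ (from y)) (strictlyInverseˡ y))
    where
    open Inverse (SignedPermutation.permutation σ) using (from; strictlyInverseˡ)
    open Bijection (↔⇒⤖ (SignedPermutation.permutation σ)) using (injective)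

  fromVec-toVec : ∀ {n} (σ : SignedPermutation n) →
                  ∃ λ τ → fromVec (toVec σ) ≡ just τ × σ ≈ τ
  fromVec-toVec σ with bijective? (extend (toVec σ))
  ... | yes b = _ , refl , λ x → sym (extend-toVec σ x)
  ... | no ¬b = contradiction (extend-toVec-bijective σ) ¬b

  fromVec-sound : ∀ {n} (w : Vec ±[ n ] n) {σ} → fromVec w ≡ just σ → toVec σ ≡ w
  fromVec-sound w eq with bijective? (extend w)
  fromVec-sound w refl | yes b = tabulate∘lookup w

  mapMaybe-complete : ∀ {n} (σ : SignedPermutation n) {ws} → toVec σ ∈ ws →
                      Any (σ ≈_) (mapMaybe fromVec ws)
  mapMaybe-complete σ {w ∷ ws} (here refl) with fromVec (toVec σ) | fromVec-toVec σ
  ... | just _ | _ , refl , σ≈τ = here σ≈τ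
  mapMaybe-complete σ {w ∷ ws} (there p) with fromVec w
  ... | just _  = there (mapMaybe-complete σ p)
  ... | nothing = mapMaybe-complete σ p

  mapMaybe-fresh : ∀ {n} (σ : SignedPermutation n) {ws} → All (toVec σ ≢_) ws →
                   All (λ τ → ¬ σ ≈ τ) (mapMaybe fromVec ws)
  mapMaybe-fresh σ [] = []
  mapMaybe-fresh σ {w ∷ ws} (p ∷ ps) with fromVec w in eq
  ... | just τ  = (λ σ≈τ → p (trans (tabulate-cong (λ i → σ≈τ (pos i))) (fromVec-sound w eq)))
                ∷ mapMaybe-fresh σ ps
  ... | nothing = mapMaybe-fresh σ ps

  mapMaybe-unique : ∀ {n} {ws : List (Vec ±[ n ] n)} → Unique ws →
                    AllPairs (λ σ τ → ¬ σ ≈ τ) (mapMaybe fromVec ws)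
  mapMaybe-unique [] = []
  mapMaybe-unique {ws = w ∷ ws} (p ∷ u) with fromVec w in eq
  ... | just σ  = mapMaybe-fresh σ (subst (λ v → All (v ≢_) ws) (sym (fromVec-sound w eq)) p)
                ∷ mapMaybe-unique u
  ... | nothing = mapMaybe-unique u

signedPermutations-complete : ∀ {n} (σ : SignedPermutation n) →
                              Any (σ ≈_) (signedPermutations n)
signedPermutations-complete σ = mapMaybe-complete σ (vectors-complete letters-complete (toVec σ))

signedPermutations-unique : ∀ n → AllPairs (λ σ τ → ¬ σ ≈ τ) (signedPermutations n)
signedPermutations-unique n = mapMaybe-unique (vectors-unique (letters-unique n) n)

count : ∀ {n} {P : Pred (SignedPermutation n) 0ℓ} → Decidable P → ℕ
count {n} P? = length (filter P? (signedPermutations n))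

-- Only positive integers are counted as fixed points.
FixedPoint : ∀ {n} → SignedPermutation n → Pred (Fin n) 0ℓ
FixedPoint σ i = to σ (pos i) ≡ pos i

fixedPoint? : ∀ {n} (σ : SignedPermutation n) → Decidable (FixedPoint σ)
fixedPoint? σ i = to σ (pos i) ≟ pos i

fixedPoints : ∀ {n} → SignedPermutation n → ℕ
fixedPoints {n} σ = length (filter (fixedPoint? σ) (allFin n))

-- DownUp a (b ∷ c ∷ …) is a > b < c > ⋯ and UpDown a (b ∷ c ∷ …) is a < b > c < ⋯.
DownUp UpDown : ℤ → List ℤ → Set
DownUp a []      = ⊤
DownUp a (b ∷ w) = a ℤ.> b × UpDown b w
UpDown a []      = ⊤
UpDown a (b ∷ w) = a ℤ.< b × DownUp b w

downUp? : ∀ a w → Dec (DownUp a w)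
upDown? : ∀ a w → Dec (UpDown a w)
downUp? a []      = yes tt
downUp? a (b ∷ w) = b ℤ.<? a ×-dec upDown? b w
upDown? a []      = yes tt
upDown? a (b ∷ w) = a ℤ.<? b ×-dec downUp? b w

data AltType : Set where
  -DU -UD +DU +UD : AltType

-- All conditions are vacuous on the empty word.
Alternating : AltType → List ℤ → Set
Alternating _   []      = ⊤
Alternating -DU (a ∷ w) = 0ℤ ℤ.> a × DownUp a w
Alternating -UD (a ∷ w) = 0ℤ ℤ.> a × UpDown a w
Alternating +DU (a ∷ w) = 0ℤ ℤ.< a × DownUp a w
Alternating +UD (a ∷ w) = 0ℤ ℤ.< a × UpDown a w

alternating? : ∀ t w → Dec (Alternating t w)
alternating? _   []      = yes tt
alternating? -DU (a ∷ w) = a ℤ.<? 0ℤ ×-dec downUp? a w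
alternating? -UD (a ∷ w) = a ℤ.<? 0ℤ ×-dec upDown? a w
alternating? +DU (a ∷ w) = 0ℤ ℤ.<? a ×-dec downUp? a w
alternating? +UD (a ∷ w) = 0ℤ ℤ.<? a ×-dec upDown? a w

-- d t k n is the number written d_k^t(n).
d : AltType → ℕ → ℕ → ℕ
d t k n = count {n} (λ σ → alternating? t (word σ) ×-dec (fixedPoints σ ℕ.≟ k))

Derangement : ∀ {n} → SignedPermutation n → Set
Derangement σ = ∀ i → ¬ FixedPoint σ i

derangement? : ∀ {n} → Decidable (Derangement {n})
derangement? σ = all? (λ i → ¬? (fixedPoint? σ i))

-- The value on the empty word is a junk value.
NegativeStart : List ℤ → Set
NegativeStart []      = ⊥
NegativeStart (a ∷ _) = a ℤ.< 0ℤ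

negativeStart? : Decidable NegativeStart
negativeStart? []      = no λ ()
negativeStart? (a ∷ _) = a ℤ.<? 0ℤ

-- 0 > σ(1) > σ(2), where for length 1 the second inequality is vacuous; the
-- value on the empty word is a junk value.
NegativeDescentStart : List ℤ → Set
NegativeDescentStart []          = ⊥
NegativeDescentStart (a ∷ [])    = 0ℤ ℤ.> a
NegativeDescentStart (a ∷ b ∷ _) = 0ℤ ℤ.> a × a ℤ.> b

negativeDescentStart? : Decidable NegativeDescentStart
negativeDescentStart? []          = no λ ()
negativeDescentStart? (a ∷ [])    = a ℤ.<? 0ℤ
negativeDescentStart? (a ∷ b ∷ _) = a ℤ.<? 0ℤ ×-dec b ℤ.<? a

Dᴮ D⁻ D⁻ᴰ : ℕ → ℕ
Dᴮ  n = count {n} derangement?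
D⁻  n = count {n} (λ σ → derangement? σ ×-dec negativeStart? (word σ))
D⁻ᴰ n = count {n} (λ σ → derangement? σ ×-dec negativeDescentStart? (word σ))

{-# OPTIONS --safe #-}

-- Consecutive positions i, i+1 with σ(i) > σ(i+1) carry at most one fixed point, and
-- when they carry exactly one, the other position is either i with σ(i) > i+1 or i+1
-- with σ(i+1) < i.  If σ is alternating with the extremal number of fixed points,
-- then, apart from the prefix forced by its type (one or two negative letters, or a
-- fixed point), each descent pair carries one fixed point.  Hence the derangement δ
-- obtained by deleting all fixed points and standardising determines σ: an excedance
-- of δ expands to (excedance, fixed point), a deficiency to (fixed point, deficiency).
-- Conversely every expansion is alternating, as the second letter of each pair is
-- smaller than the first letter of the next one.
module Submission where

open import Defs
open import Data.Nat using (ℕ; _≤_; _+_; _∸_; ⌊_/2⌋; ⌈_/2⌉)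
open import Data.Product using (_×_)
open import Relation.Binary.PropositionalEquality using (_≡_)

open import Data.Nat.Base using (zero; suc; z≤n; s≤s)
import Data.Nat.Base as ℕ
import Data.Nat.Properties as ℕ
open import Data.Fin.Base using (Fin; zero; suc; toℕ)
import Data.Fin.Properties as Fin
open import Data.Integer.Base as ℤ using (ℤ; 0ℤ; +_; +<+; -<+; -<-)
import Data.Integer.Properties as ℤ
open import Data.List.Base as List using (List; []; _∷_; length; filter)
import Data.List.Properties as List
open import Data.List.Relation.Unary.All as All using (All; []; _∷_)
import Data.List.Relation.Unary.All.Properties as All
open import Data.List.Relation.Unary.AllPairs using (AllPairs; []; _∷_)
import Data.List.Relation.Unary.AllPairs.Properties as AllPairs
open import Data.List.Relation.Unary.Any as Any using (Any; here; there; _─_)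
open import Data.List.Relation.Unary.Any.Properties using (filter⁺; lookup-result)
open import Data.List.Relation.Unary.Unique.Propositional using (Unique)
open import Data.List.Relation.Unary.Unique.Propositional.Properties using (tabulate⁺)
open import Data.Maybe.Base as Maybe using (Maybe; just; nothing)
open import Data.Product.Base using (∃; _,_; proj₁; proj₂)
open import Data.Sign.Base as Sign using ()
open import Data.Sum.Base using (inj₁; inj₂)
open import Data.Unit.Base using (tt)
open import Data.Vec.Base as Vec using (Vec; []; _∷_)
import Data.Vec.Properties as Vec
open import Data.Vec.Relation.Unary.All as AllV using ([]; _∷_) renaming (All to AllV)
import Data.Vec.Relation.Unary.All.Properties as AllV
open import Function.Base using (_∘_; id; case_of_)
open import Function.Bundles using (Inverse; mk↔ₛ′; _⇔_; mk⇔; Equivalence)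
open import Level using (0ℓ)
open import Relation.Binary.Core using (Rel; REL)
open import Relation.Binary.PropositionalEquality using (_≢_; refl; sym; trans; cong; cong₂; subst)
open import Relation.Nullary using (¬_; yes; no; contradiction)
open import Relation.Unary using (Pred; Decidable)

-- Counting up to _≈_

-- The only occurrence lost by the removal satisfies `S`, so it cannot be the one witnessing `R`.
Any-─ : ∀ {A : Set} {S R : Pred A 0ℓ} {ys} (p : Any S ys) → (∀ {y} → S y → ¬ R y) →
        Any R ys → Any R (ys ─ p)
Any-─ (here s)  disj (here r)  = contradiction r (disj s)
Any-─ (here s)  disj (there q) = q
Any-─ (there p) disj (here r)  = here r
Any-─ (there p) disj (there q) = there (Any-─ p disj q)

-- Pigeonhole principle for a relation: match the first entry of `xs` with some entry of `ys` and
-- delete the latter. By `inj` no entry inequivalent to the first is related to the deleted one, so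
-- the remaining entries keep their partners.
injective⇒length≤ : ∀ {A B : Set} {_~_ : Rel A 0ℓ} {R : REL A B 0ℓ} →
  (∀ {x x′ y} → R x y → R x′ y → x ~ x′) →
  ∀ {xs} → AllPairs (λ x x′ → ¬ x ~ x′) xs →
  ∀ {ys} → All (λ x → Any (R x) ys) xs → length xs ≤ length ys
injective⇒length≤ inj [] [] = z≤n
injective⇒length≤ inj (x≁ ∷ u) {ys} (p ∷ ps) =
  subst (_ ≤_) (sym (List.length-removeAt′ ys (Any.index p)))
    (s≤s (injective⇒length≤ inj u
      (All.zipWith (λ (x≁x′ , q) → Any-─ p (λ r r′ → x≁x′ (inj r r′)) q) (x≁ , ps))))

Any-filter : ∀ {A : Set} {P S : Pred A 0ℓ} (P? : Decidable P) → (∀ {x} → S x → P x) →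
             ∀ {xs} → Any S xs → Any S (filter P? xs)
Any-filter P? S⊆P p with filter⁺ P? p
... | inj₁ q  = q
... | inj₂ ¬P = contradiction (S⊆P (lookup-result p)) ¬P

Respects≈ : ∀ {n} → Pred (SignedPermutation n) 0ℓ → Set
Respects≈ P = ∀ {σ τ} → σ ≈ τ → P σ → P τ

module _ {m n} {P : Pred (SignedPermutation n) 0ℓ} {Q : Pred (SignedPermutation m) 0ℓ}
         (P? : Decidable P) (Q? : Decidable Q) (P-resp : Respects≈ P) (Q-resp : Respects≈ Q)
         (Φ : SignedPermutation m → SignedPermutation n)
         (Φ-cong : ∀ {δ ε} → δ ≈ ε → Φ δ ≈ Φ ε)
         (Φ-injective : ∀ {δ ε} → Q δ → Q ε → Φ δ ≈ Φ ε → δ ≈ ε)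
         (Φ-sound : ∀ {δ} → Q δ → P (Φ δ))
         (Φ-surjective : ∀ {σ} → P σ → ∃ λ δ → Q δ × Φ δ ≈ σ) where

  private
    Qs≤Ps : count Q? ≤ count P?
    Qs≤Ps = injective⇒length≤ {_~_ = _≈_} {R = λ δ σ → Q δ × Φ δ ≈ σ}
      (λ {δ} {ε} {σ} (Qδ , e) (Qε , e′) → Φ-injective Qδ Qε (λ x → trans (e x) (sym (e′ x))))
      (AllPairs.filter⁺ Q? (signedPermutations-unique m))
      (All.map (λ {δ} Qδ → Any-filter P? (λ { {σ} (_ , e) → P-resp {Φ δ} {σ} e (Φ-sound Qδ) })
                  (Any.map (Qδ ,_) (signedPermutations-complete (Φ δ))))
        (All.all-filter Q? (signedPermutations m)))

    Ps≤Qs : count P? ≤ count Q?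
    Ps≤Qs = injective⇒length≤ {_~_ = _≈_} {R = λ σ δ → Q δ × Φ δ ≈ σ}
      (λ (_ , e) (_ , e′) x → trans (sym (e x)) (e′ x))
      (AllPairs.filter⁺ P? (signedPermutations-unique n))
      (All.map (λ {σ} Pσ → case Φ-surjective Pσ of λ (δ , Qδ , e) →
                  Any-filter Q? proj₁
                    (Any.map (λ {ε} δ≈ε → Q-resp {δ} {ε} δ≈ε Qδ
                                        , λ x → trans (sym (Φ-cong {δ} {ε} δ≈ε x)) (e x))
                      (signedPermutations-complete δ)))
        (All.all-filter P? (signedPermutations n)))

  -- The graph of `Φ` up to `_≈_`, read in both directions, gives the two inequalities:
  -- `Φ-injective` provides uniqueness of partners in one, `Φ-surjective` their existence in the
  -- other.
  count-≡ : count P? ≡ count Q?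
  count-≡ = ℕ.≤-antisym Ps≤Qs Qs≤Ps

-- Kinds of letters

data Kind : Set where
  exc fix def : Kind

compare : ∀ {n} → Fin n → Fin n → Kind
compare zero    zero    = fix
compare zero    (suc j) = exc
compare (suc i) zero    = def
compare (suc i) (suc j) = compare i j

-- Every negative letter is smaller than its position and so counts as a deficiency, even if its
-- absolute value equals the position.
kind : ∀ {n} → Fin n → ±[ n ] → Kind
kind i (Sign.- , j) = def
kind i (Sign.+ , j) = compare i j

kinds : ∀ {n} → SignedPermutation n → Vec Kind n
kinds σ = Vec.tabulate (λ i → kind i (to σ (pos i)))

kinds-cong : ∀ {n} {σ τ : SignedPermutation n} → σ ≈ τ → kinds σ ≡ kinds τ
kinds-cong σ≈τ = Vec.tabulate-cong (λ i → cong (kind i) (σ≈τ (pos i)))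

compare-refl : ∀ {n} (i : Fin n) → compare i i ≡ fix
compare-refl zero    = refl
compare-refl (suc i) = compare-refl i

compare-fix : ∀ {n} {i j : Fin n} → compare i j ≡ fix → i ≡ j
compare-fix {i = zero}  {zero}  eq = refl
compare-fix {i = suc i} {suc j} eq = cong suc (compare-fix eq)

kind-fix : ∀ {n} {i : Fin n} {x} → x ≡ pos i ⇔ kind i x ≡ fix
kind-fix {i = i} = mk⇔ (λ { refl → compare-refl i })
               (λ { eq → from _ eq })
  where
  from : ∀ {n} {i : Fin n} x → kind i x ≡ fix → x ≡ pos i
  from (Sign.+ , j) eq = cong pos (sym (compare-fix eq))

fixes : ∀ {n} → Vec Kind n → ℕ
fixes []        = 0
fixes (fix ∷ c) = suc (fixes c)
fixes (exc ∷ c) = fixes c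
fixes (def ∷ c) = fixes c

-- Generalised from `allFin n`, where `f` is `id`, because the induction replaces `f` by `f ∘ suc`.
length-filter-tabulate : ∀ {A : Set} {P : Pred A 0ℓ} (P? : Decidable P) →
  ∀ {n} {f : Fin n → A} {k : Fin n → Kind} → (∀ i → P (f i) ⇔ k i ≡ fix) →
  length (filter P? (List.tabulate f)) ≡ fixes (Vec.tabulate k)
length-filter-tabulate P? {zero} h = refl
length-filter-tabulate P? {suc n} {f} {k} h with P? (f zero) | k zero | h zero
... | yes p | fix | _ = cong suc (length-filter-tabulate P? (h ∘ suc))
... | yes p | exc | e = contradiction (Equivalence.to e p) λ ()
... | yes p | def | e = contradiction (Equivalence.to e p) λ ()
... | no ¬p | fix | e = contradiction (Equivalence.from e refl) ¬p
... | no ¬p | exc | _ = length-filter-tabulate P? (h ∘ suc)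
... | no ¬p | def | _ = length-filter-tabulate P? (h ∘ suc)

fixedPoints≡fixes : ∀ {n} (σ : SignedPermutation n) → fixedPoints σ ≡ fixes (kinds σ)
fixedPoints≡fixes σ = length-filter-tabulate (fixedPoint? σ) {f = id} (λ i → kind-fix)

FixFree : ∀ {n} → Vec Kind n → Set
FixFree = AllV (_≢ fix)

derangement⇔fixFree : ∀ {n} (σ : SignedPermutation n) → Derangement σ ⇔ FixFree (kinds σ)
derangement⇔fixFree σ = mk⇔
  (λ der → AllV.tabulate⁺ (λ i eq → der i (Equivalence.from kind-fix eq)))
  (λ ff i p → AllV.tabulate⁻ ff i (Equivalence.to kind-fix p))

-- o is the position of the letter, counted from 1 as in the paper.
Reads : ℕ → ℤ → Kind → Set
Reads o a exc = + o ℤ.< a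
Reads o a fix = a ≡ + o
Reads o a def = a ℤ.< + o

data Classified (o : ℕ) : ∀ {n} → List ℤ → Vec Kind n → Set where
  []  : Classified o [] []
  _∷_ : ∀ {n a k w} {c : Vec Kind n} → Reads o a k → Classified (suc o) w c →
        Classified o (a ∷ w) (k ∷ c)

classified : ∀ {n o} {w : Fin n → ℤ} {k : Fin n → Kind} →
             (∀ i → Reads (o + toℕ i) (w i) (k i)) → Classified o (List.tabulate w) (Vec.tabulate k)
classified {zero}  h = []
classified {suc n} {o} {w} {k} h =
  subst (λ p → Reads p (w zero) (k zero)) (ℕ.+-identityʳ o) (h zero) ∷
  classified (λ i → subst (λ p → Reads p (w (suc i)) (k (suc i))) (ℕ.+-suc o (toℕ i)) (h (suc i)))

reads-compare : ∀ {n} (i j : Fin n) → Reads (toℕ i) (+ toℕ j) (compare i j)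
reads-compare zero    zero    = refl
reads-compare zero    (suc j) = +<+ (s≤s z≤n)
reads-compare (suc i) zero    = +<+ (s≤s z≤n)
reads-compare (suc i) (suc j) with compare i j | reads-compare i j
... | exc | +<+ p = +<+ (s≤s p)
... | fix | p     = cong ℤ.suc p
... | def | +<+ p = +<+ (s≤s p)

reads-kind : ∀ {n} (i : Fin n) x → Reads (suc (toℕ i)) (value x) (kind i x)
reads-kind i (Sign.- , j) = -<+
-- Raising both indices by one makes them count from 1 and leaves `compare` unchanged by
-- computation.
reads-kind i (Sign.+ , j) = reads-compare (suc i) (suc j)

classified-word : ∀ {n} (σ : SignedPermutation n) → Classified 1 (word σ) (kinds σ)
classified-word σ = classified (λ i → reads-kind i (to σ (pos i)))

value-injective : ∀ {n} {x y : ±[ n ]} → value x ≡ value y → x ≡ y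
value-injective {x = Sign.- , i} {Sign.- , j} eq = cong (Sign.- ,_) (Fin.toℕ-injective (ℤ.-[1+-injective eq))
value-injective {x = Sign.+ , i} {Sign.+ , j} eq = cong (Sign.+ ,_) (Fin.toℕ-injective (ℤ.+[1+-injective eq))

to-injective : ∀ {n} (σ : SignedPermutation n) {x y} → to σ x ≡ to σ y → x ≡ y
to-injective σ {x} {y} eq = trans (sym (strictlyInverseʳ x)) (trans (cong from eq) (strictlyInverseʳ y))
  where open Inverse (SignedPermutation.permutation σ) using (from; strictlyInverseʳ)

-- Distinctness of letters is what later makes the inequalities inside a descent pair strict.
word-unique : ∀ {n} (σ : SignedPermutation n) → Unique (word σ)
word-unique σ = tabulate⁺ (cong proj₂ ∘ to-injective σ ∘ value-injective)

-- Thinnings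

-- A strictly increasing map from `Fin m` to `Fin n`, encoded by telling for each target position
-- whether it lies in the image.
data Thinning : ℕ → ℕ → Set where
  done : Thinning 0 0
  keep : ∀ {m n} → Thinning m n → Thinning (suc m) (suc n)
  skip : ∀ {m n} → Thinning m n → Thinning m (suc n)

embed : ∀ {m n} → Thinning m n → Fin m → Fin n
embed (keep θ) zero    = zero
embed (keep θ) (suc j) = suc (embed θ j)
embed (skip θ) j       = suc (embed θ j)

project : ∀ {m n} → Thinning m n → Fin n → Maybe (Fin m)
project (keep θ) zero    = just zero
project (keep θ) (suc i) = Maybe.map suc (project θ i)
project (skip θ) zero    = nothing
project (skip θ) (suc i) = project θ i

project-embed : ∀ {m n} (θ : Thinning m n) j → project θ (embed θ j) ≡ just j
project-embed (keep θ) zero    = refl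
project-embed (keep θ) (suc j) = cong (Maybe.map suc) (project-embed θ j)
project-embed (skip θ) j       = project-embed θ j

data View {m n} (θ : Thinning m n) : Fin n → Set where
  kept    : ∀ j → View θ (embed θ j)
  skipped : ∀ {i} → project θ i ≡ nothing → View θ i

view : ∀ {m n} (θ : Thinning m n) i → View θ i
view (keep θ) zero = kept zero
view (keep θ) (suc i) with view θ i
... | kept j    = kept (suc j)
... | skipped p = skipped (cong (Maybe.map suc) p)
view (skip θ) zero = skipped refl
view (skip θ) (suc i) with view θ i
... | kept j    = kept j
... | skipped p = skipped p

compare-embed : ∀ {m n} (θ : Thinning m n) i j → compare (embed θ i) (embed θ j) ≡ compare i j
compare-embed (keep θ) zero    zero    = refl
compare-embed (keep θ) zero    (suc j) = refl
compare-embed (keep θ) (suc i) zero    = refl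
compare-embed (keep θ) (suc i) (suc j) = compare-embed θ i j
compare-embed (skip θ) i       j       = compare-embed θ i j

embed-injective : ∀ {m n} (θ : Thinning m n) {i j} → embed θ i ≡ embed θ j → i ≡ j
embed-injective θ {i} {j} eq with trans (sym (project-embed θ i)) (trans (cong (project θ) eq) (project-embed θ j))
... | refl = refl

embed± : ∀ {m n} → Thinning m n → ±[ m ] → ±[ n ]
embed± θ (s , j) = s , embed θ j

embed±-injective : ∀ {m n} (θ : Thinning m n) {x y} → embed± θ x ≡ embed± θ y → x ≡ y
embed±-injective θ eq = cong₂ _,_ (cong proj₁ eq) (embed-injective θ (cong proj₂ eq))

-- Positions and letters are relabelled by the same strictly increasing map, so standardisation
-- preserves excedances, fixed points and deficiencies.
kind-embed : ∀ {m n} (θ : Thinning m n) i x → kind (embed θ i) (embed± θ x) ≡ kind i x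
kind-embed θ i (Sign.- , j) = refl
kind-embed θ i (Sign.+ , j) = compare-embed θ i j

expand : ∀ {m n} → Thinning m n → Vec Kind m → Vec Kind n
expand done     []       = []
expand (keep θ) (k ∷ c) = k ∷ expand θ c
expand (skip θ) c       = fix ∷ expand θ c

expand-injective : ∀ {m n} (θ : Thinning m n) {c d} → expand θ c ≡ expand θ d → c ≡ d
expand-injective done     {[]} {[]} eq = refl
expand-injective (keep θ) {_ ∷ _} {_ ∷ _} eq =
  cong₂ _∷_ (Vec.∷-injectiveˡ eq) (expand-injective θ (Vec.∷-injectiveʳ eq))
expand-injective (skip θ) eq = expand-injective θ (Vec.∷-injectiveʳ eq)

expand-tabulate : ∀ {m n} (θ : Thinning m n) {f : Fin m → Kind} {g : Fin n → Kind} →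
  (∀ j → g (embed θ j) ≡ f j) → (∀ i → project θ i ≡ nothing → g i ≡ fix) →
  Vec.tabulate g ≡ expand θ (Vec.tabulate f)
expand-tabulate done     h h′ = refl
expand-tabulate (keep θ) h h′ =
  cong₂ _∷_ (h zero) (expand-tabulate θ (h ∘ suc) (λ i p → h′ (suc i) (cong (Maybe.map suc) p)))
expand-tabulate (skip θ) h h′ =
  cong₂ _∷_ (h′ zero refl) (expand-tabulate θ h (λ i p → h′ (suc i) p))

lookup-expand-skipped : ∀ {m n} (θ : Thinning m n) c {i} → project θ i ≡ nothing →
                        Vec.lookup (expand θ c) i ≡ fix
lookup-expand-skipped (keep θ) (k ∷ c) {suc i} p with project θ i in eq
... | nothing = lookup-expand-skipped θ c eq
lookup-expand-skipped (skip θ) c {zero}  p = refl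
lookup-expand-skipped (skip θ) c {suc i} p = lookup-expand-skipped θ c p

-- Inserting and deleting fixed points

module _ {m n} (θ : Thinning m n) where

  inflateMap : (±[ m ] → ±[ m ]) → ±[ n ] → ±[ n ]
  inflateMap f (s , i) with project θ i
  ... | just j  = embed± θ (f (s , j))
  ... | nothing = s , i

  inflateMap-kept : ∀ f x → inflateMap f (embed± θ x) ≡ embed± θ (f x)
  inflateMap-kept f (s , j) rewrite project-embed θ j = refl

  inflateMap-skipped : ∀ f {s i} → project θ i ≡ nothing → inflateMap f (s , i) ≡ (s , i)
  inflateMap-skipped f p rewrite p = refl

  -- Both inflated maps fix the skipped letters and act on the kept ones as `f` and `g`, so an
  -- inflated inverse is inverse to the inflated map.
  inflateMap-inverse : ∀ {f g} → (∀ x → f (g x) ≡ x) → ∀ y → inflateMap f (inflateMap g y) ≡ y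
  inflateMap-inverse {f} {g} inv (s , i) with view θ i
  ... | kept j = trans (cong (inflateMap f) (inflateMap-kept g (s , j)))
                   (trans (inflateMap-kept f (g (s , j))) (cong (embed± θ) (inv (s , j))))
  ... | skipped p = trans (cong (inflateMap f) (inflateMap-skipped g p)) (inflateMap-skipped f p)

  inflateMap-odd : ∀ {f} → (∀ x → f (neg x) ≡ neg (f x)) →
                   ∀ y → inflateMap f (neg y) ≡ neg (inflateMap f y)
  inflateMap-odd odd (s , i) with project θ i
  ... | just j  = cong (embed± θ) (odd (s , j))
  ... | nothing = refl

  inflate : SignedPermutation m → SignedPermutation n
  inflate δ = record
    { permutation = mk↔ₛ′ (inflateMap (to δ)) (inflateMap from)
                      (inflateMap-inverse strictlyInverseˡ) (inflateMap-inverse strictlyInverseʳ)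
    ; odd = inflateMap-odd (SignedPermutation.odd δ)
    }
    where open Inverse (SignedPermutation.permutation δ) using (from; strictlyInverseˡ; strictlyInverseʳ)

  inflate-cong : ∀ {δ ε} → δ ≈ ε → inflate δ ≈ inflate ε
  inflate-cong δ≈ε (s , i) with project θ i
  ... | just j  = cong (embed± θ) (δ≈ε (s , j))
  ... | nothing = refl

  inflate-injective : ∀ {δ ε} → inflate δ ≈ inflate ε → δ ≈ ε
  inflate-injective {δ} {ε} eq x = embed±-injective θ
    (trans (sym (inflateMap-kept (to δ) x)) (trans (eq (embed± θ x)) (inflateMap-kept (to ε) x)))

  kinds-inflate : ∀ δ → kinds (inflate δ) ≡ expand θ (kinds δ)
  kinds-inflate δ = expand-tabulate θ
    (λ j → trans (cong (kind (embed θ j)) (inflateMap-kept (to δ) (pos j))) (kind-embed θ j (to δ (pos j))))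
    (λ i p → Equivalence.to kind-fix (inflateMap-skipped (to δ) p))

  module _ (σ : SignedPermutation n)
           (σ-fixes : ∀ {i} → project θ i ≡ nothing → to σ (pos i) ≡ pos i) where

    open Inverse (SignedPermutation.permutation σ) using (from; strictlyInverseˡ; strictlyInverseʳ)

    private
      fixes± : ∀ {s i} → project θ i ≡ nothing → to σ (s , i) ≡ (s , i)
      fixes± {Sign.+} p = σ-fixes p
      fixes± {Sign.- } {i} p = trans (SignedPermutation.odd σ (pos i)) (cong neg (σ-fixes p))

      -- A kept letter cannot go to a skipped one: `f` fixes the latter, so injectivity would make
      -- the kept letter equal to it.
      restrict : (f : ±[ n ] → ±[ n ]) → (∀ {x y} → f x ≡ f y → x ≡ y) →
                 (∀ {s i} → project θ i ≡ nothing → f (s , i) ≡ (s , i)) →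
                 ∀ x → ∃ λ y → embed± θ y ≡ f (embed± θ x)
      restrict f f-inj f-fixes x with f (embed± θ x) in eq
      ... | s , i with view θ i
      ...   | kept j = (s , j) , refl
      ...   | skipped p with f-inj (trans eq (sym (f-fixes {s} p)))
      ...     | refl with trans (sym (project-embed θ (proj₂ x))) p
      ...       | ()

      down : ∀ x → ∃ λ y → embed± θ y ≡ to σ (embed± θ x)
      down = restrict (to σ) (to-injective σ) fixes±

      up : ∀ x → ∃ λ y → embed± θ y ≡ from (embed± θ x)
      up = restrict from
        (λ {x} {y} eq → trans (sym (strictlyInverseˡ x)) (trans (cong (to σ) eq) (strictlyInverseˡ y)))
        (λ p → trans (cong from (sym (fixes± p))) (strictlyInverseʳ _))

    deflate : SignedPermutation m
    deflate = record
      { permutation = mk↔ₛ′ (proj₁ ∘ down) (proj₁ ∘ up)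
          (λ x → embed±-injective θ (trans (proj₂ (down _))
                   (trans (cong (to σ) (proj₂ (up x))) (strictlyInverseˡ _))))
          (λ x → embed±-injective θ (trans (proj₂ (up _))
                   (trans (cong from (proj₂ (down x))) (strictlyInverseʳ _))))
      ; odd = λ x → embed±-injective θ (trans (proj₂ (down (neg x)))
                (trans (SignedPermutation.odd σ (embed± θ x)) (cong neg (sym (proj₂ (down x))))))
      }

    inflate-deflate : inflate deflate ≈ σ
    inflate-deflate (s , i) with view θ i
    ... | kept j    = trans (inflateMap-kept (to deflate) (s , j)) (proj₂ (down (s , j)))
    ... | skipped p = trans (inflateMap-skipped (to deflate) p) (sym (fixes± p))

-- The positions to be filled with fixed points, depending on the kinds of the
-- remaining letters.
record Template (m n : ℕ) : Set where
  field
    thin      : Vec Kind m → Thinning m n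
  expansion : Vec Kind m → Vec Kind n
  expansion c = expand (thin c) c
  field
    -- The thinning varies with the kinds, so this does not follow from `expand-injective`, which
    -- concerns one fixed thinning.
    injective : ∀ {c d} → FixFree c → FixFree d → expansion c ≡ expansion d → c ≡ d

  fill : SignedPermutation m → SignedPermutation n
  fill δ = inflate (thin (kinds δ)) δ

  kinds-fill : ∀ δ → kinds (fill δ) ≡ expansion (kinds δ)
  kinds-fill δ = kinds-inflate (thin (kinds δ)) δ

  Fits : Vec Kind n → Set
  Fits k = ∃ λ c → FixFree c × k ≡ expansion c

  fits-fill : ∀ {δ} → Derangement δ → Fits (kinds (fill δ))
  fits-fill {δ} der = kinds δ , Equivalence.to (derangement⇔fixFree δ) der , kinds-fill δ

  fill-cong : ∀ {δ ε} → δ ≈ ε → fill δ ≈ fill ε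
  fill-cong {δ} {ε} δ≈ε x =
    trans (inflate-cong (thin (kinds δ)) {δ} {ε} δ≈ε x)
      (cong (λ c → to (inflate (thin c) ε) x) (kinds-cong {σ = δ} {ε} δ≈ε))

  -- The kinds of a derangement can be recovered from the kinds of its filling; hence both fillings
  -- use the same thinning, and `inflate-injective` applies.
  fill-injective : ∀ {δ ε} → Derangement δ → Derangement ε → fill δ ≈ fill ε → δ ≈ ε
  fill-injective {δ} {ε} dδ dε eq = inflate-injective (thin (kinds δ)) {δ} {ε} λ x →
    trans (eq x) (cong (λ c → to (inflate (thin c) ε) x) (sym kinds≡))
    where
    kinds≡ : kinds δ ≡ kinds ε
    kinds≡ = injective (Equivalence.to (derangement⇔fixFree δ) dδ) (Equivalence.to (derangement⇔fixFree ε) dε)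
      (trans (sym (kinds-fill δ)) (trans (kinds-cong {σ = fill δ} {fill ε} eq) (kinds-fill ε)))

  -- All positions skipped by `thin c` are fixed points of `σ`, so `σ` can be deflated along it. The
  -- result has kinds `c`, and `fill` therefore chooses the same thinning again.
  fill-surjective : ∀ {σ} → Fits (kinds σ) → ∃ λ δ → Derangement δ × fill δ ≈ σ
  fill-surjective {σ} (c , ff , eq) =
    δ , Equivalence.from (derangement⇔fixFree δ) (subst FixFree (sym kinds≡) ff) ,
    λ x → trans (cong (λ c → to (inflate (thin c) δ) x) kinds≡) (inflate-deflate (thin c) σ σ-fixes x)
    where
    σ-fixes : ∀ {i} → project (thin c) i ≡ nothing → to σ (pos i) ≡ pos i
    σ-fixes {i} p = Equivalence.from kind-fix
      (trans (sym (Vec.lookup∘tabulate _ i))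
        (trans (cong (λ k → Vec.lookup k i) eq) (lookup-expand-skipped (thin c) c p)))
    δ : SignedPermutation _
    δ = deflate (thin c) σ σ-fixes
    kinds≡ : kinds δ ≡ c
    kinds≡ = expand-injective (thin c)
      (trans (sym (kinds-inflate (thin c) δ))
        (trans (kinds-cong {σ = inflate (thin c) δ} {σ} (inflate-deflate (thin c) σ σ-fixes)) eq))

-- Transfer of counts along a template

word-cong : ∀ {n} {σ τ : SignedPermutation n} → σ ≈ τ → word σ ≡ word τ
word-cong σ≈τ = List.tabulate-cong (λ i → cong value (σ≈τ (pos i)))

derangement-cong : ∀ {n} → Respects≈ (Derangement {n})
derangement-cong σ≈τ der i p = der i (trans (σ≈τ (pos i)) p)

open Template using (Fits; fill; fits-fill; fill-cong; fill-injective; fill-surjective)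

-- The bijection is `fill T`. For each type it remains to see when a filled derangement alternates,
-- that the template has `k` fixed points, and that alternation with `k` fixed points forces the
-- template.
extremal-count : ∀ {m n t k} (T : Template m n)
  {Q : Pred (SignedPermutation m) 0ℓ} (Q? : Decidable Q) → Respects≈ Q →
  (∀ {δ} → Q δ → Derangement δ) →
  (∀ {δ} → Derangement δ → Alternating t (word (fill T δ)) → Q δ) →
  (∀ {δ} → Q δ → Alternating t (word (fill T δ))) →
  (∀ {c} → Fits T c → fixes c ≡ k) →
  (∀ {σ} → Alternating t (word σ) → fixes (kinds σ) ≡ k → Fits T (kinds σ)) →
  d t k n ≡ count Q?
extremal-count {t = t} {k} T {Q} Q? Q-resp Q⇒der to-Q from-Q fits-fixes fits = count-≡ _ Q?
  (λ {σ} {τ} → P-resp {σ} {τ})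
  Q-resp (fill T) (λ {δ} {ε} → fill-cong T {δ} {ε})
  (λ {δ} {ε} Qδ Qε → fill-injective T {δ} {ε} (Q⇒der Qδ) (Q⇒der Qε))
  (λ {δ} Qδ → from-Q Qδ , trans (fixedPoints≡fixes (fill T δ)) (fits-fixes (fits-fill T {δ} (Q⇒der Qδ))))
  (λ {σ} (alt , fp) → case fill-surjective T {σ} (fits {σ} alt (trans (sym (fixedPoints≡fixes σ)) fp)) of
    λ (δ , der , eq) → δ , to-Q der (subst (Alternating t) (sym (word-cong {σ = fill T δ} {σ} eq)) alt) , eq)
  where
  P-resp : Respects≈ (λ σ → Alternating t (word σ) × fixedPoints σ ≡ k)
  P-resp {σ} {τ} e (alt , fp) =
      subst (Alternating t) (word-cong {σ = σ} {τ} e) alt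
    , trans (fixedPoints≡fixes τ)
        (trans (cong fixes (sym (kinds-cong {σ = σ} {τ} e))) (trans (sym (fixedPoints≡fixes σ)) fp))

-- Descent pairs

-- Junk value when fix occurs in the vector.
pairThinning : ∀ n → Vec Kind ⌊ n /2⌋ → Thinning ⌊ n /2⌋ n
pairThinning zero          c         = done
pairThinning (suc zero)    c         = skip done
pairThinning (suc (suc n)) (def ∷ c) = skip (keep (pairThinning n c))
pairThinning (suc (suc n)) (_   ∷ c) = keep (skip (pairThinning n c))

pairs : ∀ n → Template ⌊ n /2⌋ n
pairs n = record { thin = pairThinning n ; injective = inj n }
  where
  -- The expansion is decoded pair by pair: a pair opening with `fix` comes from a deficiency, one
  -- opening with `exc` from an excedance.
  inj : ∀ n {c d : Vec Kind ⌊ n /2⌋} → FixFree c → FixFree d →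
        expand (pairThinning n c) c ≡ expand (pairThinning n d) d → c ≡ d
  inj zero {[]} {[]} _ _ _ = refl
  inj (suc zero) {[]} {[]} _ _ _ = refl
  inj (suc (suc n)) {exc ∷ c} {exc ∷ d} (_ ∷ p) (_ ∷ q) eq =
    cong (exc ∷_) (inj n p q (Vec.∷-injectiveʳ (Vec.∷-injectiveʳ eq)))
  inj (suc (suc n)) {def ∷ c} {def ∷ d} (_ ∷ p) (_ ∷ q) eq =
    cong (def ∷_) (inj n p q (Vec.∷-injectiveʳ (Vec.∷-injectiveʳ eq)))
  inj (suc (suc n)) {exc ∷ c} {def ∷ d} _ _ ()
  inj (suc (suc n)) {def ∷ c} {exc ∷ d} _ _ ()
  inj (suc (suc n)) {fix ∷ c} (p ∷ _) _ _ = contradiction refl p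
  inj (suc (suc n)) {_} {fix ∷ d} _ (q ∷ _) _ = contradiction refl q

Paired : ∀ {n} → Vec Kind n → Set
Paired {n} = Fits (pairs n)

-- One fixed point per pair, and for odd `n` one more in the unpaired last position; hence the
-- ceiling.
paired-fixes : ∀ n {k : Vec Kind n} → Paired k → fixes k ≡ ⌈ n /2⌉
paired-fixes zero       ([] , _ , refl) = refl
paired-fixes (suc zero) ([] , _ , refl) = refl
paired-fixes (suc (suc n)) (exc ∷ c , _ ∷ p , refl) = cong suc (paired-fixes n (c , p , refl))
paired-fixes (suc (suc n)) (def ∷ c , _ ∷ p , refl) = cong suc (paired-fixes n (c , p , refl))
paired-fixes (suc (suc n)) (fix ∷ c , p ∷ _ , refl) = contradiction refl p

<∧≢⇒suc< : ∀ {o a} → + o ℤ.< a → a ≢ + suc o → + suc o ℤ.< a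
<∧≢⇒suc< (+<+ o<a) a≢ = +<+ (ℕ.≤∧≢⇒< o<a (a≢ ∘ cong (+_) ∘ sym))

<suc∧≢⇒< : ∀ {o a} → a ℤ.< + suc o → a ≢ + o → a ℤ.< + o
<suc∧≢⇒< -<+       a≢ = -<+
<suc∧≢⇒< (+<+ a<) a≢ = +<+ (ℕ.≤∧≢⇒< (ℕ.≤-pred a<) (a≢ ∘ cong (+_)))

+<suc : ∀ {o} → + o ℤ.< + suc o
+<suc = +<+ ℕ.≤-refl

-- The invariant is that the preceding letter `a` is below the next position `o`. A pair opens with
-- a letter at least `o`, which gives the ascent, and closes with one at most `o + 1`, which
-- restores the invariant at `o + 2`.
paired⇒upDown : ∀ n {o a w} {k : Vec Kind n} → a ℤ.< + o → Classified o w k → Unique w →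
                Paired k → UpDown a w
paired⇒upDown zero a<o [] _ _ = tt
paired⇒upDown (suc zero) a<o (refl ∷ []) _ ([] , _ , refl) = a<o , tt
paired⇒upDown (suc (suc n)) a<o (o<x ∷ refl ∷ cl) ((x≢y ∷ _) ∷ _ ∷ u) (exc ∷ c , _ ∷ p , refl) =
  -- The excedance is above `o` and differs from the fixed point `o + 1` after it, so it exceeds
  -- that too.
  ℤ.<-trans a<o o<x , <∧≢⇒suc< o<x x≢y , paired⇒upDown n +<suc cl u (c , p , refl)
paired⇒upDown (suc (suc n)) a<o (refl ∷ y< ∷ cl) ((x≢y ∷ _) ∷ _ ∷ u) (def ∷ c , _ ∷ p , refl) =
  -- Dually, the deficiency is below `o + 1` and differs from the fixed point `o` before it.
  a<o , <suc∧≢⇒< y< (x≢y ∘ sym) , paired⇒upDown n (ℤ.<-trans y< +<suc) cl u (c , p , refl)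
paired⇒upDown (suc (suc n)) a<o cl u (fix ∷ c , p ∷ _ , refl) = contradiction refl p

-- Induction on descent pairs: each must contribute a fixed point, and the descent then decides the
-- kind of the other letter. Assuming only a lower bound lets the induction supply the matching
-- upper bound as well.
upDown⇒paired : ∀ n {o a w} {k : Vec Kind n} → Classified o w k → UpDown a w →
                ⌈ n /2⌉ ≤ fixes k → Paired k
upDown⇒paired zero [] _ _ = [] , [] , refl
upDown⇒paired (suc zero) {k = fix ∷ []} (_ ∷ []) _ _ = [] , [] , refl
upDown⇒paired (suc zero) {k = exc ∷ []} _ _ ()
upDown⇒paired (suc zero) {k = def ∷ []} _ _ ()
upDown⇒paired (suc (suc n)) {k = x ∷ y ∷ k} (p ∷ q ∷ cl) (_ , y<x , ud) le = go x y p q le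
  where
  rest : ⌈ n /2⌉ ≤ fixes k → Paired k
  rest = upDown⇒paired n cl ud
  -- A suffix with too many fixed points would still be paired by induction, and so have exactly
  -- `⌈ n /2⌉` of them.
  too-many : suc ⌈ n /2⌉ ≤ fixes k → ∀ {A : Set} → A
  too-many le = contradiction (ℕ.≤-trans le (ℕ.≤-reflexive (paired-fixes n (rest (ℕ.≤-trans (ℕ.n≤1+n _) le)))))
                  (ℕ.<-irrefl refl)
  extend-exc : Paired k → Paired (exc ∷ fix ∷ k)
  extend-exc (c , ff , refl) = exc ∷ c , (λ ()) ∷ ff , refl
  extend-def : Paired k → Paired (fix ∷ def ∷ k)
  extend-def (c , ff , refl) = def ∷ c , (λ ()) ∷ ff , refl
  go : ∀ x y → Reads _ _ x → Reads _ _ y → suc ⌈ n /2⌉ ≤ fixes (x ∷ y ∷ k) → Paired (x ∷ y ∷ k)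
  go exc fix _ _ le = extend-exc (rest (ℕ.≤-pred le))
  go fix def _ _ le = extend-def (rest (ℕ.≤-pred le))
  -- In this and the next two cases the reading of the kinds puts the second letter above the first,
  -- against the descent.
  go fix fix refl refl _ = contradiction y<x (ℤ.<-asym +<suc)
  go fix exc refl q    _ = contradiction y<x (ℤ.<-asym (ℤ.<-trans +<suc q))
  go def fix p    refl _ = contradiction y<x (ℤ.<-asym (ℤ.<-trans p +<suc))
  go exc exc _ _ le = too-many le
  go exc def _ _ le = too-many le
  go def exc _ _ le = too-many le
  go def def _ _ le = too-many le

-- The four types

keepT : ∀ {m n} → Template m n → Template (suc m) (suc n)
keepT T = record
  { thin      = λ { (_ ∷ c) → keep (Template.thin T c) }
  ; injective = λ { {_ ∷ _} {_ ∷ _} (_ ∷ p) (_ ∷ q) eq →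
      cong₂ _∷_ (Vec.∷-injectiveˡ eq) (Template.injective T p q (Vec.∷-injectiveʳ eq)) }
  }

skipT : ∀ {m n} → Template m n → Template m (suc n)
skipT T = record
  { thin      = skip ∘ Template.thin T
  ; injective = λ p q eq → Template.injective T p q (Vec.∷-injectiveʳ eq)
  }

keepT-fits : ∀ {m n k x} (T : Template m n) → x ≢ fix → Fits T k → Fits (keepT T) (x ∷ k)
keepT-fits T x≢fix (c , ff , refl) = _ ∷ c , x≢fix ∷ ff , refl

keepT-fits⁻ : ∀ {m n k x} (T : Template m n) → Fits (keepT T) (x ∷ k) → x ≢ fix × Fits T k
keepT-fits⁻ T (_ ∷ c , p ∷ ff , refl) = p , c , ff , refl

keepT-fixes : ∀ {m n l} (T : Template m n) → (∀ {k} → Fits T k → fixes k ≡ l) →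
              ∀ {k} → Fits (keepT T) k → fixes k ≡ l
keepT-fixes T h {x ∷ k} f with keepT-fits⁻ T f
keepT-fixes T h {exc ∷ k} _ | _ , f = h f
keepT-fixes T h {def ∷ k} _ | _ , f = h f
keepT-fixes T h {fix ∷ k} _ | p , _ = contradiction refl p

negative⇒def : ∀ {o a} k → a ℤ.< 0ℤ → Reads o a k → k ≡ def
negative⇒def exc a<0 o<a  = contradiction (ℤ.<-trans o<a a<0) λ { (+<+ ()) }
negative⇒def fix a<0 refl = contradiction a<0 λ { (+<+ ()) }
negative⇒def def _   _    = refl

negative⇒< : ∀ {o a} → a ℤ.< 0ℤ → a ℤ.< + o
negative⇒< a<0 = ℤ.<-≤-trans a<0 (ℤ.+≤+ z≤n)

-- Type `+DU`: pairs only

-- Prepending 0 turns a word of this type into an up-down chain, whose descents begin at the first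
-- letter.
+DU⇔upDown : ∀ w → Alternating +DU w ⇔ UpDown 0ℤ w
+DU⇔upDown []      = mk⇔ id id
+DU⇔upDown (_ ∷ _) = mk⇔ id id

+DU-count : ∀ n → d +DU ⌈ n /2⌉ n ≡ Dᴮ ⌊ n /2⌋
+DU-count n = extremal-count {t = +DU} (pairs n) derangement?
  (λ {δ} {ε} → derangement-cong {σ = δ} {ε}) id (λ der _ → der)
  (λ {δ} der → Equivalence.from (+DU⇔upDown (word (fill (pairs n) δ)))
    (paired⇒upDown n (+<+ (s≤s z≤n)) (classified-word (fill (pairs n) δ)) (word-unique (fill (pairs n) δ))
      (fits-fill (pairs n) {δ} der)))
  (paired-fixes n)
  (λ {σ} alt eq → upDown⇒paired n (classified-word σ) (Equivalence.to (+DU⇔upDown (word σ)) alt)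
    (ℕ.≤-reflexive (sym eq)))

-- Type `+UD`: a fixed point, then pairs

-- The last `n` letters hold at most `⌈ n /2⌉` fixed points, so the extra one must be the first
-- letter.
+UD⇒fits : ∀ n {w} {k : Vec Kind (suc n)} → Classified 1 w k → Alternating +UD w →
           fixes k ≡ suc ⌈ n /2⌉ → Fits (skipT (pairs n)) k
+UD⇒fits n {k = x ∷ k} (p ∷ cl) (_ , ud) eq = go x eq
  where
  rest : ⌈ n /2⌉ ≤ fixes k → Paired k
  rest = upDown⇒paired n cl ud
  too-many : ∀ {A : Set} → fixes k ≡ suc ⌈ n /2⌉ → A
  too-many eq = contradiction
    (trans (sym eq) (paired-fixes n (rest (ℕ.≤-trans (ℕ.n≤1+n _) (ℕ.≤-reflexive (sym eq))))))
    ℕ.1+n≢n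
  go : ∀ x → fixes (x ∷ k) ≡ suc ⌈ n /2⌉ → Fits (skipT (pairs n)) (x ∷ k)
  go fix eq with rest (ℕ.≤-reflexive (sym (ℕ.suc-injective eq)))
  ... | c , ff , refl = c , ff , refl
  go exc eq = too-many eq
  go def eq = too-many eq

fits⇒+UD : ∀ n {w} {k : Vec Kind (suc n)} → Classified 1 w k → Unique w →
           Fits (skipT (pairs n)) k → Alternating +UD w
fits⇒+UD n (refl ∷ cl) (_ ∷ u) (c , ff , refl) =
  -- The initial fixed point has value 1, below the next position 2, which starts the invariant.
  +<+ (s≤s z≤n) , paired⇒upDown n +<suc cl u (c , ff , refl)

+UD-count : ∀ n → d +UD (suc ⌈ n /2⌉) (suc n) ≡ Dᴮ ⌊ n /2⌋
+UD-count n = extremal-count {t = +UD} T derangement?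
  (λ {δ} {ε} → derangement-cong {σ = δ} {ε}) id (λ der _ → der)
  (λ {δ} der → fits⇒+UD n (classified-word (fill T δ)) (word-unique (fill T δ)) (fits-fill T {δ} der))
  (λ { (c , ff , refl) → cong suc (paired-fixes n (c , ff , refl)) })
  (λ {σ} → +UD⇒fits n (classified-word σ))
  where
  T : Template ⌊ n /2⌋ (suc n)
  T = skipT (pairs n)

-- Type `-UD`: a negative letter, then pairs

-- A negative first letter is a deficiency, so all the fixed points lie in the up-down chain after
-- it.
-UD⇒fits : ∀ n {w} {k : Vec Kind (suc n)} → Classified 1 w k → Alternating -UD w →
           fixes k ≡ ⌈ n /2⌉ → Fits (keepT (pairs n)) k
-UD⇒fits n {k = x ∷ k} (p ∷ cl) (a<0 , ud) eq with negative⇒def x a<0 p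
... | refl = keepT-fits (pairs n) (λ ()) (upDown⇒paired n cl ud (ℕ.≤-reflexive (sym eq)))

fits⇒-UD : ∀ n {w} {k : Vec Kind (suc n)} → Classified 1 w k → Unique w →
           Fits (keepT (pairs n)) k → NegativeStart w → Alternating -UD w
fits⇒-UD n (_ ∷ cl) (_ ∷ u) f a<0 =
  a<0 , paired⇒upDown n (negative⇒< a<0) cl u (proj₂ (keepT-fits⁻ (pairs n) f))

value-embed-neg : ∀ {m n} (θ : Thinning m n) x → value x ℤ.< 0ℤ ⇔ value (embed± θ x) ℤ.< 0ℤ
value-embed-neg θ (Sign.- , i) = mk⇔ (λ _ → -<+) (λ _ → -<+)
value-embed-neg θ (Sign.+ , i) = mk⇔ (λ { (+<+ ()) }) (λ { (+<+ ()) })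

-UD-count : ∀ n → d -UD ⌈ n /2⌉ (suc n) ≡ D⁻ (suc ⌊ n /2⌋)
-UD-count n = extremal-count {t = -UD} T _
  (λ {δ} {ε} e (der , neg) → derangement-cong {σ = δ} {ε} e der
                           , subst NegativeStart (word-cong {σ = δ} {ε} e) neg)
  proj₁
  (λ {δ} der (neg , _) → der , Equivalence.from (first-negative δ) neg)
  (λ {δ} (der , neg) → fits⇒-UD n (classified-word (fill T δ)) (word-unique (fill T δ))
    (fits-fill T {δ} der) (Equivalence.to (first-negative δ) neg))
  (keepT-fixes (pairs n) (paired-fixes n))
  (λ {σ} → -UD⇒fits n (classified-word σ))
  where
  T : Template (suc ⌊ n /2⌋) (suc n)
  T = keepT (pairs n)
  first-negative : ∀ δ → NegativeStart (word δ) ⇔ NegativeStart (word (fill T δ))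
  -- Position `zero` is kept, so the first letter of the filling is by computation the embedded
  -- first letter of `δ`.
  first-negative δ = value-embed-neg (Template.thin T (kinds δ)) (to δ (pos zero))

-- Type `-DU`: two negative letters, then pairs

-- The initial descent makes the second letter negative too; both are deficiencies, and the pairs
-- start at the third letter.
-DU⇒fits : ∀ n {w} {k : Vec Kind (suc (suc n))} → Classified 1 w k → Alternating -DU w →
           fixes k ≡ ⌈ n /2⌉ → Fits (keepT (keepT (pairs n))) k
-DU⇒fits n {k = x ∷ y ∷ k} (p ∷ q ∷ cl) (a<0 , b<a , ud) eq
  with negative⇒def x a<0 p | negative⇒def y (ℤ.<-trans b<a a<0) q
... | refl | refl = keepT-fits (keepT (pairs n)) (λ ()) (keepT-fits (pairs n) (λ ())
                      (upDown⇒paired n cl ud (ℕ.≤-reflexive (sym eq))))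

fits⇒-DU : ∀ n {w} {k : Vec Kind (suc (suc n))} → Classified 1 w k → Unique w →
           Fits (keepT (keepT (pairs n))) k → NegativeDescentStart w → Alternating -DU w
fits⇒-DU n (_ ∷ _ ∷ cl) (_ ∷ _ ∷ u) f (a<0 , b<a) =
  a<0 , b<a , paired⇒upDown n (negative⇒< (ℤ.<-trans b<a a<0)) cl u
    (proj₂ (keepT-fits⁻ (pairs n) (proj₂ (keepT-fits⁻ (keepT (pairs n)) f))))

embed-< : ∀ {m n} (θ : Thinning m n) i j → toℕ i ℕ.< toℕ j ⇔ toℕ (embed θ i) ℕ.< toℕ (embed θ j)
embed-< (keep θ) zero    zero    = mk⇔ (λ ()) (λ ())
embed-< (keep θ) zero    (suc j) = mk⇔ (λ _ → s≤s z≤n) (λ _ → s≤s z≤n)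
embed-< (keep θ) (suc i) zero    = mk⇔ (λ ()) (λ ())
embed-< (keep θ) (suc i) (suc j) =
  mk⇔ (s≤s ∘ Equivalence.to (embed-< θ i j) ∘ ℕ.≤-pred) (s≤s ∘ Equivalence.from (embed-< θ i j) ∘ ℕ.≤-pred)
embed-< (skip θ) i       j       =
  mk⇔ (s≤s ∘ Equivalence.to (embed-< θ i j)) (Equivalence.from (embed-< θ i j) ∘ ℕ.≤-pred)

-- Embedding keeps signs and the order of absolute values. It serves to carry the initial descent
-- between a derangement and its filling.
value-embed-< : ∀ {m n} (θ : Thinning m n) x y →
                value x ℤ.< value y ⇔ value (embed± θ x) ℤ.< value (embed± θ y)
value-embed-< θ (Sign.- , i) (Sign.- , j) =
  mk⇔ (λ { (-<- p) → -<- (Equivalence.to (embed-< θ j i) p) }) (λ { (-<- p) → -<- (Equivalence.from (embed-< θ j i) p) })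
value-embed-< θ (Sign.- , i) (Sign.+ , j) = mk⇔ (λ _ → -<+) (λ _ → -<+)
value-embed-< θ (Sign.+ , i) (Sign.- , j) = mk⇔ (λ ()) (λ ())
value-embed-< θ (Sign.+ , i) (Sign.+ , j) =
  mk⇔ (λ { (+<+ p) → +<+ (s≤s (Equivalence.to (embed-< θ i j) (ℕ.≤-pred p))) })
      (λ { (+<+ p) → +<+ (s≤s (Equivalence.from (embed-< θ i j) (ℕ.≤-pred p))) })

-DU-count : ∀ n → d -DU ⌈ n /2⌉ (suc (suc n)) ≡ D⁻ᴰ (suc (suc ⌊ n /2⌋))
-DU-count n = extremal-count {t = -DU} T _
  (λ {δ} {ε} e (der , neg) → derangement-cong {σ = δ} {ε} e der
                           , subst NegativeDescentStart (word-cong {σ = δ} {ε} e) neg)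
  proj₁
  (λ {δ} der (a<0 , b<a , _) → der , Equivalence.from (first-negative δ) a<0 , Equivalence.from (first-descent δ) b<a)
  (λ {δ} (der , a<0 , b<a) → fits⇒-DU n (classified-word (fill T δ)) (word-unique (fill T δ))
    (fits-fill T {δ} der) (Equivalence.to (first-negative δ) a<0 , Equivalence.to (first-descent δ) b<a))
  (keepT-fixes (keepT (pairs n)) (keepT-fixes (pairs n) (paired-fixes n)))
  (λ {σ} → -DU⇒fits n (classified-word σ))
  where
  T : Template (suc (suc ⌊ n /2⌋)) (suc (suc n))
  T = keepT (keepT (pairs n))
  first-negative : ∀ δ → _ ⇔ _
  first-negative δ = value-embed-neg (Template.thin T (kinds δ)) (to δ (pos zero))
  first-descent : ∀ δ → _ ⇔ _
  first-descent δ = value-embed-< (Template.thin T (kinds δ)) (to δ (pos (suc zero))) (to δ (pos zero))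

theorem2p5 : (n : ℕ) → 1 ≤ n →
    (d -DU ⌈ n ∸ 2 /2⌉ n ≡ D⁻ᴰ ⌊ n + 2 /2⌋) ×
    (d -UD ⌈ n ∸ 1 /2⌉ n ≡ D⁻ ⌊ n + 1 /2⌋) ×
    (d +DU ⌈ n /2⌉ n ≡ Dᴮ ⌊ n /2⌋) ×
    (d +UD ⌈ n + 1 /2⌉ n ≡ Dᴮ ⌊ n ∸ 1 /2⌋)
theorem2p5 (suc n) _ = -DU-case n , -UD-case , +DU-count (suc n) , +UD-case
  where
  -DU-case : ∀ n → d -DU ⌈ suc n ∸ 2 /2⌉ (suc n) ≡ D⁻ᴰ ⌊ suc n + 2 /2⌋
  -- Length one has no second letter, and both sides evaluate to 1; truncated subtraction agrees
  -- here, as the ceiling of -1/2 is 0.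
  -DU-case zero    = refl
  -DU-case (suc n) = trans (-DU-count n) (cong (λ k → D⁻ᴰ ⌊ suc (suc k) /2⌋) (ℕ.+-comm 2 n))
  -UD-case : d -UD ⌈ n /2⌉ (suc n) ≡ D⁻ ⌊ suc n + 1 /2⌋
  -UD-case = trans (-UD-count n) (cong (λ k → D⁻ ⌊ suc k /2⌋) (ℕ.+-comm 1 n))
  +UD-case : d +UD ⌈ suc n + 1 /2⌉ (suc n) ≡ Dᴮ ⌊ n /2⌋
  +UD-case = trans (cong (λ k → d +UD ⌈ suc k /2⌉ (suc n)) (ℕ.+-comm n 1)) (+UD-count n)
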